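{- For every feasible solution of the linear program $P_{\mathrm{comb}}$, its objective value $\omega_{\mathcal P}$ is a lower bound for the optimal value of $P$.
   Context: Linear problem. $P_l$ is the linear program: minimize $\sum_n c_n x_n$ subject to $\sum_n c_{m,n}x_n\ge b_m$ for all $m$, and $x_n\ge 0$ for all $n$ (finitely many real variables $x_n$ and inequalities indexed by $m$; the index sets $\{m\}$ and $\{n\}$ are taken disjoint, and $r$ denotes an index running over their union). Its dual solution space is $V_0=\{v: v_m\ge 0\ \forall m,\ r_n(v)\ge 0\ \forall n\}$, where $r_n(v)=c_n-\sum_m c_{m,n}v_m$ is the reduced cost of $x_n$, and its dual objective is $\omega(v)=\sum_m b_m v_m$. Problem $P$. $P$ minimizes the same objective $\sum_n c_nx_n$ over a subset of the feasible set of $P_l$. There are finitely many case differentiations $i\in I$, each with a finite nonempty set of cases $j\in J_i$. Case $j$ of differentiation $i$ consists of finitely many additional linear inequalities $\sum_n d^{i,j}_{k,n}x_n\ge e^{i,j}_k$ (indexed by $k$). For every $i\in I$, every feasible point of $P$ satisfies all inequalities of at least one case $j\in J_i$. The optimal value of $P$ is the infimum of the objective over its feasible points ($+\infty$ if there are none). Cases. $V_{i,j}$ is the dual solution space of $P_l$ with the inequalities of case $(i,j)$ added: the set of pairs $(v,z)$ with $v_m\ge0$, $z_k\ge 0$ and $r_n(v,z):=c_n-\sum_m c_{m,n}v_m-\sum_k d^{i,j}_{k,n}z_k\ge 0$ for all $m,k,n$. Its dual objective is $\omega_{i,j}(v,z)=\sum_m b_mv_m+\sum_k e^{i,j}_kz_k$.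 The linear program $P_{\mathrm{comb}}$. Its variables are $y_0\in V_0$, $y_{i,j}=(v_{i,j},z_{i,j})\in V_{i,j}$ for all $i\in I$, $j\in J_i$, and real numbers $\Delta_i^r$ and $\omega_i$ for all $i\in I$ and all indices $r$. Membership in $V_0$ and $V_{i,j}$ is imposed through the defining linear inequalities. The following are linear (affine) expressions in the variables: $\Delta^m_{i,j}=(y_0)_m-(v_{i,j})_m$, $\Delta^n_{i,j}=r_n(y_0)-r_n(y_{i,j})$, $\omega^{\mathrm{inc}}_{i,j}=\omega_{i,j}(y_{i,j})-\omega(y_0)$, $l_m=(y_0)_m$, $l_n=r_n(y_0)$. The remaining constraints are $$\Delta_i^r\ge\Delta_{i,j}^r\ \ \forall i,j,r,\qquad \omega_i\le\omega^{\mathrm{inc}}_{i,j}\ \ \forall i,j,\qquad \Delta^r_{\mathcal P}:=\sum_i\Delta_i^r\le l_r\ \ \forall r.$$ The objective, to be maximized, is $\omega_{\mathcal P}=\omega(y_0)+\sum_i\omega_i$. -}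

module Defs where

open import Level using (Level; suc; _⊔_)
open import Algebra.Bundles using (CommutativeRing)
open import Algebra.Core using (Op₁; Op₂)
open import Algebra.Definitions using (Invertible)
open import Algebra.Structures using (IsCommutativeRing)
open import Axiom.ExcludedMiddle using (ExcludedMiddle)
open import Data.Empty using (⊥-elim)
open import Data.Fin.Base using (Fin)
open import Data.Nat.Base using (ℕ; NonZero)
open import Data.Product.Base using (∃; _×_; _,_; proj₁; proj₂)
open import Data.Sum.Base using (_⊎_; inj₁; inj₂)
open import Data.Vec.Functional using (Vector)
open import Relation.Binary.Core using (Rel)
open import Relation.Binary.Structures using (IsTotalOrder)
open import Relation.Nullary using (¬_; yes; no)
open import Relation.Nullary.Construct.Add.Extrema using (_±; ⊥±; ⊤±; [_])
open import Relation.Unary using (Pred)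
import Algebra.Properties.Monoid.Sum as MonoidSum
import Relation.Binary.Construct.Add.Extrema.NonStrict as Extended

IsInfimum : ∀ {a b ℓ} {A : Set a} {B : Set b} →
            Rel A ℓ → (B → A) → A → Set (a ⊔ b ⊔ ℓ)
IsInfimum _≤_ f x = (∀ t → x ≤ f t) × (∀ y → (∀ t → y ≤ f t) → y ≤ x)

-- The standard library has no real numbers.  They are axiomatised as a
-- (Dedekind-)complete totally ordered field, which classically determines
-- them up to isomorphism.

record CompleteOrderedField (ℓ : Level) : Set (suc ℓ) where
  infix  8 -_
  infixl 7 _*_
  infixl 6 _+_
  infix  4 _≈_ _≤_
  field
    Carrier           : Set ℓ
    _≈_               : Rel Carrier ℓ
    _≤_               : Rel Carrier ℓ
    _+_               : Op₂ Carrier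
    _*_               : Op₂ Carrier
    -_                : Op₁ Carrier
    0#                : Carrier
    1#                : Carrier
    isCommutativeRing : IsCommutativeRing _≈_ _+_ _*_ -_ 0# 1#
    0≉1               : ¬ (0# ≈ 1#)
    invertible        : ∀ x → ¬ (x ≈ 0#) → Invertible _≈_ 1# _*_ x
    isTotalOrder      : IsTotalOrder _≈_ _≤_
    +-monoˡ-≤         : ∀ {x y} z → x ≤ y → x + z ≤ y + z
    *-nonNeg          : ∀ {x y} → 0# ≤ x → 0# ≤ y → 0# ≤ x * y
    complete          : ∀ {B : Set ℓ} (f : B → Carrier) → B →
                        (∃ λ y → ∀ t → y ≤ f t) → ∃ (IsInfimum _≤_ f)

  commutativeRing : CommutativeRing ℓ ℓ
  commutativeRing = record { isCommutativeRing = isCommutativeRing }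

module Problems {ℓ : Level} (ℝ : CompleteOrderedField ℓ) where

  open CompleteOrderedField ℝ using (Carrier; _≤_; complete)
  open CommutativeRing (CompleteOrderedField.commutativeRing ℝ)
    using (_+_; _*_; _-_; 0#; +-monoid)
  open MonoidSum +-monoid using (sum-syntax)
  open Extended _≤_ using (_≤±_) public
  open Extended _≤_ using ([_]; ⊥±≤_; _≤⊤±; [≤]-injective)

  record LinearProblem : Set ℓ where
    field
      M N : ℕ
      c   : Vector Carrier N
      C   : Fin M → Fin N → Carrier
      b   : Vector Carrier M

    objective : Vector Carrier N → Carrier
    objective x = ∑[ n < N ] (c n * x n)

    PrimalFeasible : Pred (Vector Carrier N) ℓ
    PrimalFeasible x = (∀ m → b m ≤ ∑[ n < N ] (C m n * x n)) × (∀ n → 0# ≤ x n)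

    reducedCost : Vector Carrier M → Vector Carrier N
    reducedCost v n = c n - ∑[ m < M ] (C m n * v m)

    dualObjective : Vector Carrier M → Carrier
    dualObjective v = ∑[ m < M ] (b m * v m)

    V₀ : Pred (Vector Carrier M) ℓ
    V₀ v = (∀ m → 0# ≤ v m) × (∀ n → 0# ≤ reducedCost v n)

  record Problem : Set (suc ℓ) where
    field
      Pₗ : LinearProblem
    open LinearProblem Pₗ public

    field
      Feasible          : Pred (Vector Carrier N) ℓ
      feasible⇒feasible : ∀ {x} → Feasible x → PrimalFeasible x

      I         : ℕ
      J         : Fin I → ℕ
      J-nonZero : ∀ i → NonZero (J i)
      K         : ∀ i → Fin (J i) → ℕ
      d         : ∀ i j → Fin (K i j) → Fin N → Carrier
      e         : ∀ i j → Vector Carrier (K i j)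

    SatisfiesCase : ∀ i → Fin (J i) → Pred (Vector Carrier N) ℓ
    SatisfiesCase i j x = ∀ k → e i j k ≤ ∑[ n < N ] (d i j k n * x n)

    field
      covers : ∀ i {x} → Feasible x → ∃ λ j → SatisfiesCase i j x

    -- The value is taken in the extended reals: ⊤± is +∞ (attained exactly
    -- when there are no feasible points) and ⊥± is -∞.

    IsOptimalValue : Carrier ± → Set ℓ
    IsOptimalValue = IsInfimum {B = ∃ Feasible} _≤±_ λ (x , _) → [ objective x ]

    private
      ⊤±≰[] : ∀ {x} → ¬ (⊤± ≤± [ x ])
      ⊤±≰[] ()

    optimalValue-exists : ExcludedMiddle ℓ → ∃ IsOptimalValue
    optimalValue-exists em with em {∃ Feasible}
    ... | no  empty = ⊤± , (λ t → ⊥-elim (empty t)) , λ y _ → y ≤⊤±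
    ... | yes p
      with em {∃ λ y → ∀ (t : ∃ Feasible) → y ≤ objective (proj₁ t)}
    ...   | no unbounded = ⊥± , (λ _ → ⊥±≤ _) , λ where
              ⊥±    _  → ⊥±≤ ⊥±
              [ y ] lb → ⊥-elim (unbounded (y , λ t → [≤]-injective (lb t)))
              ⊤±    lb → ⊥-elim (⊤±≰[] (lb p))
    ...   | yes bounded
      with a , lower , greatest ← complete {∃ Feasible} (λ (x , _) → objective x) p bounded
      = [ a ] , (λ t → [ lower t ]) , λ where
              ⊥±    _  → ⊥±≤ _
              [ y ] lb → [ greatest y (λ t → [≤]-injective (lb t)) ]
              ⊤±    lb → ⊥-elim (⊤±≰[] (lb p))

    module _ (i : Fin I) (j : Fin (J i)) where

      caseReducedCost : Vector Carrier M → Vector Carrier (K i j) → Vector Carrier N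
      caseReducedCost v z n =
        c n - ∑[ m < M ] (C m n * v m) - ∑[ k < K i j ] (d i j k n * z k)

      caseDualObjective : Vector Carrier M → Vector Carrier (K i j) → Carrier
      caseDualObjective v z =
        ∑[ m < M ] (b m * v m) + ∑[ k < K i j ] (e i j k * z k)

      V : Vector Carrier M → Vector Carrier (K i j) → Set ℓ
      V v z = (∀ m → 0# ≤ v m) × (∀ k → 0# ≤ z k) × (∀ n → 0# ≤ caseReducedCost v z n)

    -- The indices r: inj₁ for constraints m, inj₂ for variables n.
    Index : Set
    Index = Fin M ⊎ Fin N

    -- An assignment of values to the variables of P_comb.
    record CombPoint : Set ℓ where
      field
        y₀  : Vector Carrier M
        v   : ∀ i → Fin (J i) → Vector Carrier M
        z   : ∀ i j → Vector Carrier (K i j)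
        Δ   : Fin I → Index → Carrier
        ω   : Fin I → Carrier

      Δᶜ : ∀ i → Fin (J i) → Index → Carrier
      Δᶜ i j (inj₁ m) = y₀ m - v i j m
      Δᶜ i j (inj₂ n) = reducedCost y₀ n - caseReducedCost i j (v i j) (z i j) n

      ωⁱⁿᶜ : ∀ i → Fin (J i) → Carrier
      ωⁱⁿᶜ i j = caseDualObjective i j (v i j) (z i j) - dualObjective y₀

      l : Index → Carrier
      l (inj₁ m) = y₀ m
      l (inj₂ n) = reducedCost y₀ n

      Δ𝒫 : Index → Carrier
      Δ𝒫 r = ∑[ i < I ] Δ i r

      ω𝒫 : Carrier
      ω𝒫 = dualObjective y₀ + ∑[ i < I ] ω i

    record CombFeasible (y : CombPoint) : Set ℓ where
      open CombPoint y
      field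
        y₀∈V₀  : V₀ y₀
        y∈V    : ∀ i j → V i j (v i j) (z i j)
        Δ-max  : ∀ i j r → Δᶜ i j r ≤ Δ i r
        ω-min  : ∀ i j → ω i ≤ ωⁱⁿᶜ i j
        Δ𝒫≤l   : ∀ r → Δ𝒫 r ≤ l r

{-# OPTIONS --safe #-}

-- Fix a feasible point x of P and weigh every index r by w r ≥ 0: the slack of
-- constraint m, or the coordinate x n.  Write W f = Σ_r f r * w r.  The LP duality
-- identity for Pₗ reads ω(y₀) + W l = c·x.  If x satisfies case (i , j), then
-- weak duality gives ω_{i,j}(y_{i,j}) + W l_{i,j} ≤ c·x, where l_{i,j} collects
-- the multipliers and reduced costs of y_{i,j}.  Subtracting, the increase
-- of the bound is at most W Δ_{i,j} ≤ W Δ_i, and summing over i yields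
-- Σ_i ω_i ≤ W Δ𝒫 ≤ W l = c·x - ω(y₀).

module Submission where

open import Defs
open import Algebra.Bundles using (CommutativeRing)
open import Data.Fin.Base using (Fin; zero; suc)
open import Data.Nat.Base using (ℕ; zero; suc)
open import Data.Product.Base using (_,_)
open import Data.Sum.Base using (_⊎_; inj₁; inj₂; [_,_]′)
open import Data.Vec.Functional using (Vector)
open import Function.Base using (_∘_)
open import Relation.Binary.Bundles using (TotalOrder)
open import Relation.Nullary.Construct.Add.Extrema using (_±; [_])
import Algebra.Properties.CommutativeSemigroup as CommutativeSemigroupProperties
import Algebra.Properties.Group as GroupProperties
import Algebra.Properties.Semiring.Sum as SemiringSum
import Relation.Binary.Construct.Add.Extrema.NonStrict as Extended
import Relation.Binary.Reasoning.PartialOrder as PosetReasoning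

module OrderedSums {ℓ} (ℝ : CompleteOrderedField ℓ) where

  open CompleteOrderedField ℝ public
    using (_≤_; isTotalOrder; +-monoˡ-≤; *-nonNeg)
  open CommutativeRing (CompleteOrderedField.commutativeRing ℝ) public
    using ( Carrier; _≈_; _+_; _*_; _-_; -_; 0#; sym; trans
          ; +-cong; +-congˡ; +-congʳ; +-comm; +-assoc; +-identityˡ
          ; *-congˡ; *-congʳ; *-comm; *-assoc; distribʳ; -‿inverseʳ
          ; semiring; +-group; +-commutativeSemigroup )
  open SemiringSum semiring public
    using (sum; sum-syntax; sum-cong-≋; ∑-distrib-+; ∑-comm; *-distribʳ-sum)
  open GroupProperties +-group public
    using () renaming (//-rightDividesˡ to [y-x]+x≈y; //-rightDividesʳ to [y+x]-x≈y)
  open CommutativeSemigroupProperties +-commutativeSemigroup public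
    using () renaming (interchange to +-interchange)

  totalOrder : TotalOrder ℓ ℓ ℓ
  totalOrder = record { isTotalOrder = isTotalOrder }

  open TotalOrder totalOrder public
    using (poset) renaming (refl to ≤-refl)

  open PosetReasoning poset

  +-mono-≤ : ∀ {x y z w} → x ≤ y → z ≤ w → x + z ≤ y + w
  +-mono-≤ {x} {y} {z} {w} x≤y z≤w = begin
    x + z  ≤⟨ +-monoˡ-≤ z x≤y ⟩
    y + z  ≈⟨ +-comm y z ⟩
    z + y  ≤⟨ +-monoˡ-≤ y z≤w ⟩
    w + y  ≈⟨ +-comm w y ⟩
    y + w  ∎

  +-cancelʳ-≤ : ∀ z {x y} → x + z ≤ y + z → x ≤ y
  +-cancelʳ-≤ z {x} {y} x+z≤y+z = begin
    x          ≈⟨ [y+x]-x≈y z x ⟨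
    x + z - z  ≤⟨ +-monoˡ-≤ (- z) x+z≤y+z ⟩
    y + z - z  ≈⟨ [y+x]-x≈y z y ⟩
    y          ∎

  x≤y⇒0≤y-x : ∀ {x y} → x ≤ y → 0# ≤ y - x
  x≤y⇒0≤y-x {x} {y} x≤y = begin
    0#     ≈⟨ -‿inverseʳ x ⟨
    x - x  ≤⟨ +-monoˡ-≤ (- x) x≤y ⟩
    y - x  ∎

  *-monoˡ-≤ : ∀ {x y z} → 0# ≤ z → x ≤ y → x * z ≤ y * z
  *-monoˡ-≤ {x} {y} {z} 0≤z x≤y = begin
    x * z                ≈⟨ +-identityˡ (x * z) ⟨
    0# + x * z           ≤⟨ +-monoˡ-≤ (x * z) (*-nonNeg (x≤y⇒0≤y-x x≤y) 0≤z) ⟩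
    (y - x) * z + x * z  ≈⟨ distribʳ z (y - x) x ⟨
    (y - x + x) * z      ≈⟨ *-congʳ ([y-x]+x≈y x y) ⟩
    y * z                ∎

  sum-mono-≤ : ∀ {n} {f g : Vector Carrier n} → (∀ i → f i ≤ g i) → sum f ≤ sum g
  sum-mono-≤ {zero}  f≤g = ≤-refl
  sum-mono-≤ {suc n} f≤g = +-mono-≤ (f≤g zero) (sum-mono-≤ (f≤g ∘ suc))

  ∑-distribʳ-+ : ∀ {n} (f g w : Vector Carrier n) →
                 ∑[ i < n ] ((f i + g i) * w i) ≈
                 ∑[ i < n ] (f i * w i) + ∑[ i < n ] (g i * w i)
  ∑-distribʳ-+ f g w =
    trans (sum-cong-≋ λ i → distribʳ (w i) (f i) (g i))
          (∑-distrib-+ (λ i → f i * w i) (λ i → g i * w i))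

  -- The subtracted part is added back on the left, so the cancellation is pointwise and no negation
  -- has to be moved through a sum.
  ∑-split : ∀ {n} (f g w : Vector Carrier n) →
            ∑[ i < n ] ((f i - g i) * w i) + ∑[ i < n ] (g i * w i) ≈
            ∑[ i < n ] (f i * w i)
  ∑-split f g w =
    trans (sym (∑-distribʳ-+ (λ i → f i - g i) g w))
          (sum-cong-≋ λ i → *-congʳ ([y-x]+x≈y (g i) (f i)))

  -- The transpose rule ⟨Ax, u⟩ = ⟨Aᵀu, x⟩, by exchanging the two sums. It turns multipliers on rows
  -- into coefficients on columns, for `C` as well as for the rows `d i j` of a case.
  ∑-adjoint : ∀ {k n} (A : Fin k → Fin n → Carrier)
              (x : Vector Carrier n) (u : Vector Carrier k) →
              ∑[ i < k ] ((∑[ j < n ] (A i j * x j)) * u i) ≈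
              ∑[ j < n ] ((∑[ i < k ] (A i j * u i)) * x j)
  ∑-adjoint {k} {n} A x u = begin-equality
    ∑[ i < k ] ((∑[ j < n ] (A i j * x j)) * u i)
      ≈⟨ (sum-cong-≋ λ i → *-distribʳ-sum (u i) (λ j → A i j * x j)) ⟩
    ∑[ i < k ] (∑[ j < n ] (A i j * x j * u i))
      ≈⟨ ∑-comm (λ i j → A i j * x j * u i) ⟩
    ∑[ j < n ] (∑[ i < k ] (A i j * x j * u i))
      ≈⟨ (sum-cong-≋ λ j → sum-cong-≋ λ i → swap (A i j) (x j) (u i)) ⟩
    ∑[ j < n ] (∑[ i < k ] (A i j * u i * x j))
      ≈⟨ (sum-cong-≋ λ j → *-distribʳ-sum (x j) (λ i → A i j * u i)) ⟨
    ∑[ j < n ] ((∑[ i < k ] (A i j * u i)) * x j) ∎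
    where
    swap : ∀ a b c → a * b * c ≈ a * c * b
    swap a b c = trans (*-assoc a b c) (trans (*-congˡ (*-comm b c)) (sym (*-assoc a c b)))

  module Weighted {M N : ℕ} (w : Fin M ⊎ Fin N → Carrier) where

    W : (Fin M ⊎ Fin N → Carrier) → Carrier
    W f = ∑[ m < M ] (f (inj₁ m) * w (inj₁ m)) + ∑[ n < N ] (f (inj₂ n) * w (inj₂ n))

    W-mono-≤ : (∀ r → 0# ≤ w r) → ∀ {f g} → (∀ r → f r ≤ g r) → W f ≤ W g
    W-mono-≤ 0≤w f≤g =
      +-mono-≤ (sum-mono-≤ λ m → *-monoˡ-≤ (0≤w (inj₁ m)) (f≤g (inj₁ m)))
               (sum-mono-≤ λ n → *-monoˡ-≤ (0≤w (inj₂ n)) (f≤g (inj₂ n)))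

    W-cong : ∀ {f g} → (∀ r → f r ≈ g r) → W f ≈ W g
    W-cong f≈g = +-cong (sum-cong-≋ λ m → *-congʳ (f≈g (inj₁ m)))
                        (sum-cong-≋ λ n → *-congʳ (f≈g (inj₂ n)))

    W-+ : ∀ f g → W (λ r → f r + g r) ≈ W f + W g
    W-+ f g = trans
      (+-cong (∑-distribʳ-+ (f ∘ inj₁) (g ∘ inj₁) (w ∘ inj₁))
              (∑-distribʳ-+ (f ∘ inj₂) (g ∘ inj₂) (w ∘ inj₂)))
      (+-interchange _ _ _ _)

    W-split : ∀ f g → W (λ r → f r - g r) + W g ≈ W f
    W-split f g = trans (sym (W-+ (λ r → f r - g r) g)) (W-cong λ r → [y-x]+x≈y (g r) (f r))

    -- Linearity of `W`; it merges the separate bounds `W (Δ i)` into the single `W Δ𝒫` that the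
    -- coupling constraint controls.
    W-sum : ∀ {k} (f : Fin k → Fin M ⊎ Fin N → Carrier) →
            ∑[ i < k ] W (f i) ≈ W (λ r → ∑[ i < k ] f i r)
    W-sum {k} f = trans (∑-distrib-+ rows columns) (+-cong (pull inj₁) (pull inj₂))
      where
      rows columns : Vector Carrier k
      rows    i = ∑[ m < M ] (f i (inj₁ m) * w (inj₁ m))
      columns i = ∑[ n < N ] (f i (inj₂ n) * w (inj₂ n))

      pull : ∀ {n} (r : Fin n → Fin M ⊎ Fin N) →
             ∑[ i < k ] (∑[ j < n ] (f i (r j) * w (r j))) ≈
             ∑[ j < n ] ((∑[ i < k ] f i (r j)) * w (r j))
      pull r = trans (∑-comm λ i j → f i (r j) * w (r j))
                     (sum-cong-≋ λ j → sym (*-distribʳ-sum (w (r j)) (λ i → f i (r j))))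

module Bound {ℓ} (ℝ : CompleteOrderedField ℓ) (P : Problems.Problem ℝ) where

  open OrderedSums ℝ
  open Problems ℝ using (module Problem)
  open Problem P
  open PosetReasoning poset

  module _ {x : Vector Carrier N} (x∈P : Feasible x) where

    weight : Index → Carrier
    weight (inj₁ m) = ∑[ n < N ] (C m n * x n) - b m
    weight (inj₂ n) = x n

    -- Feasibility of `x` for `Pₗ` enters here; it is what makes `W` monotone.
    weight-nonNeg : ∀ r → 0# ≤ weight r
    weight-nonNeg with rows , nonNeg ← feasible⇒feasible x∈P =
      λ where
        (inj₁ m) → x≤y⇒0≤y-x (rows m)
        (inj₂ n) → nonNeg n

    open Weighted weight

    slack-identity : ∀ v →
      dualObjective v + ∑[ m < M ] (v m * weight (inj₁ m)) ≈
      ∑[ n < N ] ((∑[ m < M ] (C m n * v m)) * x n)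
    slack-identity v = begin-equality
      dualObjective v + ∑[ m < M ] (v m * weight (inj₁ m))
        ≈⟨ +-congˡ (sum-cong-≋ λ m → *-comm (v m) (weight (inj₁ m))) ⟩
      dualObjective v + ∑[ m < M ] (weight (inj₁ m) * v m)
        ≈⟨ +-comm _ _ ⟩
      ∑[ m < M ] (weight (inj₁ m) * v m) + dualObjective v
        ≈⟨ ∑-split (λ m → ∑[ n < N ] (C m n * x n)) b v ⟩
      ∑[ m < M ] ((∑[ n < N ] (C m n * x n)) * v m)
        ≈⟨ ∑-adjoint C x v ⟩
      ∑[ n < N ] ((∑[ m < M ] (C m n * v m)) * x n) ∎

    -- The products summed by `W` are those of complementary slackness, so `W` is exactly the
    -- duality gap between `v` and `x`. An equation is required: one direction bounds `ωⁱⁿᶜ`, the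
    -- other closes the final estimate.
    duality-identity : ∀ v → dualObjective v + W [ v , reducedCost v ]′ ≈ objective x
    duality-identity v = begin-equality
      dualObjective v + W [ v , reducedCost v ]′
        ≈⟨ +-assoc _ _ _ ⟨
      dualObjective v + ∑[ m < M ] (v m * weight (inj₁ m)) + ∑[ n < N ] (reducedCost v n * x n)
        ≈⟨ +-congʳ (slack-identity v) ⟩
      ∑[ n < N ] (Cᵀv n * x n) + ∑[ n < N ] (reducedCost v n * x n)
        ≈⟨ +-comm _ _ ⟩
      ∑[ n < N ] (reducedCost v n * x n) + ∑[ n < N ] (Cᵀv n * x n)
        ≈⟨ ∑-split c Cᵀv x ⟩
      objective x ∎
      where
      Cᵀv : Vector Carrier N
      Cᵀv n = ∑[ m < M ] (C m n * v m)

    module _ {i : Fin I} {j : Fin (J i)} (x∈case : SatisfiesCase i j x) where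

      -- Only an inequality, because `W` ranges over the indices of `Pₗ`: the slack terms of the
      -- added rows `k` are discarded, and they are nonnegative since `z` is and `x` satisfies the
      -- case.
      case-weak-duality : ∀ v z → (∀ k → 0# ≤ z k) →
        caseDualObjective i j v z + W [ v , caseReducedCost i j v z ]′ ≤ objective x
      case-weak-duality v z 0≤z = begin
        caseDualObjective i j v z + W [ v , caseReducedCost i j v z ]′
          ≈⟨ +-congˡ (+-comm _ _) ⟩
        (dualObjective v + ez) + (rx + vs)
          ≈⟨ +-assoc _ _ _ ⟩
        dualObjective v + (ez + (rx + vs))
          ≤⟨ +-mono-≤ ≤-refl (+-monoˡ-≤ _ ez≤dᵀz) ⟩
        dualObjective v + (∑[ n < N ] (dᵀz n * x n) + (rx + vs))
          ≈⟨ +-congˡ (trans (sym (+-assoc _ _ _)) (+-comm _ _)) ⟩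
        dualObjective v + (vs + (∑[ n < N ] (dᵀz n * x n) + rx))
          -- `caseReducedCost i j v z n` unfolds to `reducedCost v n - dᵀz n`, so the `dᵀz` sum
          -- cancels and the reduced costs of `Pₗ` remain.
          ≈⟨ +-congˡ (+-congˡ (trans (+-comm _ _) (∑-split (reducedCost v) dᵀz x))) ⟩
        dualObjective v + W [ v , reducedCost v ]′
          ≈⟨ duality-identity v ⟩
        objective x ∎
        where
        ez rx vs : Carrier
        ez = ∑[ k < K i j ] (e i j k * z k)
        rx = ∑[ n < N ] (caseReducedCost i j v z n * x n)
        vs = ∑[ m < M ] (v m * weight (inj₁ m))

        dᵀz : Vector Carrier N
        dᵀz n = ∑[ k < K i j ] (d i j k n * z k)

        ez≤dᵀz : ez ≤ ∑[ n < N ] (dᵀz n * x n)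
        ez≤dᵀz = begin
          ez
            ≤⟨ sum-mono-≤ (λ k → *-monoˡ-≤ (0≤z k) (x∈case k)) ⟩
          ∑[ k < K i j ] ((∑[ n < N ] (d i j k n * x n)) * z k)
            ≈⟨ ∑-adjoint (d i j) x z ⟩
          ∑[ n < N ] (dᵀz n * x n) ∎

    module _ {y : CombPoint} (y∈Pcomb : CombFeasible y) where

      open CombPoint y
      open CombFeasible y∈Pcomb

      -- `W` evaluates its argument only at `inj₁ m` and `inj₂ n`, where both clauses of `Δᶜ`
      -- compute to the required differences.
      Δᶜ-split : ∀ i j →
        W (Δᶜ i j) + W [ v i j , caseReducedCost i j (v i j) (z i j) ]′ ≈ W [ y₀ , reducedCost y₀ ]′
      Δᶜ-split i j =
        W-split [ y₀ , reducedCost y₀ ]′ [ v i j , caseReducedCost i j (v i j) (z i j) ]′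

      ωⁱⁿᶜ≤W[Δᶜ] : ∀ {i j} → SatisfiesCase i j x → ωⁱⁿᶜ i j ≤ W (Δᶜ i j)
      -- Adding `D₀ + L` clears both subtractions: `D₀` completes `ωⁱⁿᶜ` to the dual objective of
      -- the case, and `L` completes `W (Δᶜ i j)` to the gap of `y₀`.
      ωⁱⁿᶜ≤W[Δᶜ] {i} {j} x∈case = +-cancelʳ-≤ (D₀ + L) (begin
        ωⁱⁿᶜ i j + (D₀ + L)                            ≈⟨ +-assoc _ _ _ ⟨
        ωⁱⁿᶜ i j + D₀ + L                              ≈⟨ +-congʳ ([y-x]+x≈y D₀ _) ⟩
        caseDualObjective i j (v i j) (z i j) + L
          ≤⟨ case-weak-duality x∈case (v i j) (z i j) 0≤z ⟩
        objective x                                    ≈⟨ duality-identity y₀ ⟨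
        D₀ + W [ y₀ , reducedCost y₀ ]′                ≈⟨ +-congˡ (Δᶜ-split i j) ⟨
        D₀ + (W (Δᶜ i j) + L)                          ≈⟨ +-assoc _ _ _ ⟨
        D₀ + W (Δᶜ i j) + L                            ≈⟨ +-congʳ (+-comm _ _) ⟩
        W (Δᶜ i j) + D₀ + L                            ≈⟨ +-assoc _ _ _ ⟩
        W (Δᶜ i j) + (D₀ + L)                          ∎)
        where
        D₀ L : Carrier
        D₀ = dualObjective y₀
        L  = W [ v i j , caseReducedCost i j (v i j) (z i j) ]′
        0≤z : ∀ k → 0# ≤ z i j k
        0≤z with _ , 0≤z , _ ← y∈V i j = 0≤z

      ω≤W[Δ] : ∀ i → ω i ≤ W (Δ i)
      -- The case `j` depends on `x`, but `ω i` and `Δ i` do not: `ω-min` and `Δ-max` hold for every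
      -- case, hence for this one.
      ω≤W[Δ] i with j , x∈case ← covers i x∈P = begin
        ω i         ≤⟨ ω-min i j ⟩
        ωⁱⁿᶜ i j    ≤⟨ ωⁱⁿᶜ≤W[Δᶜ] x∈case ⟩
        W (Δᶜ i j)  ≤⟨ W-mono-≤ weight-nonNeg (Δ-max i j) ⟩
        W (Δ i)     ∎

      ω𝒫≤objective : ω𝒫 ≤ objective x
      ω𝒫≤objective = begin
        dualObjective y₀ + ∑[ i < I ] ω i      ≤⟨ +-mono-≤ ≤-refl (sum-mono-≤ ω≤W[Δ]) ⟩
        dualObjective y₀ + ∑[ i < I ] W (Δ i)  ≈⟨ +-congˡ (W-sum Δ) ⟩
        dualObjective y₀ + W Δ𝒫                ≤⟨ +-mono-≤ ≤-refl (W-mono-≤ weight-nonNeg Δ𝒫≤l) ⟩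
        dualObjective y₀ + W l                 ≈⟨ duality-identity y₀ ⟩
        objective x                            ∎

theorem2p9 :
    ∀ {ℓ} (ℝ : CompleteOrderedField ℓ) →
    let open CompleteOrderedField ℝ using (Carrier)
        open Problems ℝ
    in
    (P : Problem) →
    let open Problem P
    in
    (y : CombPoint) → CombFeasible y →
    (opt : Carrier ±) → IsOptimalValue opt →
    [ CombPoint.ω𝒫 y ] ≤± opt
theorem2p9 ℝ P y y∈Pcomb opt (_ , greatest) =
  -- `opt` is a greatest lower bound in the extended reals, so a real bound at each feasible point
  -- suffices, also when `opt` is infinite.
  greatest _ λ (x , x∈P) → Extended.[ Bound.ω𝒫≤objective ℝ P x∈P y∈Pcomb ]
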